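{- For every integer $n\ge 2$, six cops suffice to catch the robber on the graph $DG_n$; that is, $\mathrm{ent}(DG_n)\le 6$. Here $DG_n$ is the $3$-regular graph on $2n$ vertices obtained by taking a Hamilton cycle of length $2n$ with vertices $u_1,u_2,\ldots,u_n,v_1,v_2,\ldots,v_n$ in this cyclic order and connecting every vertex to its antipode on the cycle by an edge, i.e. adding the $n$ edges $\{u_i,v_i\}$ for $1\le i\le n$.
   Context: Entanglement game on a finite undirected graph $G$ with $k$ cops: First the robber chooses a starting vertex, and all $k$ cops are outside the graph. In every turn, the cops either all stay where they are, or exactly one of them flies (from wherever it is, on or off the graph) to the current position of the robber. Regardless of which of these happened, the robber then has to move to a neighbor of his current position that is not occupied by a cop. If there is no such neighbor, the cops win. The robber wins if he can run away indefinitely. Both sides have full information. The entanglement number $\mathrm{ent}(G)$ is the minimal integer $k$ such that $k$ cops have a strategy to catch the robber on $G$. -}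

module Defs where

open import Data.Fin.Base using (Fin; toℕ)
open import Data.Fin.Properties using (+↔⊎)
open import Data.List.Base using (List; applyDownFrom)
open import Data.Maybe.Base using (Maybe; just; nothing)
open import Data.Nat.Base using (ℕ; zero; suc; _+_; _≤_)
open import Data.Nat.Properties using (1+n≢n)
open import Data.Product.Base using (∃-syntax; _×_)
open import Data.Sum.Base using (_⊎_; inj₁; inj₂)
open import Data.Vec.Base using (Vec; replicate; _[_]≔_)
open import Data.Vec.Membership.Propositional using (_∈_)
open import Function.Bundles using (_↔_)
open import Level using (0ℓ)
open import Relation.Binary.Construct.Closure.Symmetric
  using (SymClosure; fwd; bwd; symmetric)
open import Relation.Binary.Core using (Rel)
open import Relation.Binary.Definitions using (Symmetric)
open import Relation.Binary.PropositionalEquality using (_≡_; sym)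
open import Relation.Nullary using (¬_)

record Graph : Set₁ where
  field
    Vertex  : Set
    order   : ℕ
    finite  : Fin order ↔ Vertex
    Adj     : Rel Vertex 0ℓ
    adj-sym : Symmetric Adj
    no-loop : ∀ x → ¬ Adj x x

module Entanglement (G : Graph) where
  open Graph G

  -- `nothing` is a cop who is still outside the graph.
  Cops : ℕ → Set
  Cops k = Vec (Maybe Vertex) k

  Occupied : ∀ {k} → Cops k → Vertex → Set
  Occupied c x = just x ∈ c

  -- `just i` sends cop i to the robber's current position; `nothing` leaves
  -- all cops where they are.
  CopMove : ℕ → Set
  CopMove k = Maybe (Fin k)

  fly : ∀ {k} → CopMove k → Vertex → Cops k → Cops k
  fly nothing  r c = c
  fly (just i) r c = c [ i ]≔ just r

  -- The argument is the list of all robber positions so far, the current one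
  -- first.  The cops' own earlier moves are determined by it and the strategy.
  Strategy : ℕ → Set
  Strategy k = List Vertex → CopMove k

  -- In a play ρ, ρ 0 is the start chosen by the robber and ρ t his position
  -- after t moves.
  copsAt : ∀ {k} → Strategy k → (ℕ → Vertex) → ℕ → Cops k
  copsAt {k} σ ρ zero    = replicate k nothing
  copsAt     σ ρ (suc t) =
    fly (σ (applyDownFrom ρ (suc t))) (ρ t) (copsAt σ ρ t)

  LegalAt : ∀ {k} → Strategy k → (ℕ → Vertex) → ℕ → Set
  LegalAt σ ρ t =
    Adj (ρ t) (ρ (suc t)) × ¬ Occupied (copsAt σ ρ (suc t)) (ρ (suc t))

  RunsIndefinitely : ∀ {k} → Strategy k → (ℕ → Vertex) → Set
  RunsIndefinitely σ ρ = ∀ t → LegalAt σ ρ t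

  -- A play ends only when the robber has no legal move, i.e. by a win of the
  -- cops, so a strategy is winning when it admits no infinite play.
  Winning : ∀ {k} → Strategy k → Set
  Winning σ = ∀ ρ → ¬ RunsIndefinitely σ ρ

  CopsSuffice : ℕ → Set
  CopsSuffice k = ∃[ σ ] Winning {k} σ

  -- k is the entanglement number of G.
  IsEnt : ℕ → Set
  IsEnt k = CopsSuffice k × (∀ j → CopsSuffice j → k ≤ j)

open Entanglement public using (CopsSuffice; IsEnt)

-- Indices run from 0 to n - 1, so the cycle is u 0, …, u (n-1), v 0, …, v (n-1).
pattern u i = inj₁ i
pattern v i = inj₂ i

data Edge (n : ℕ) : Rel (Fin n ⊎ Fin n) 0ℓ where
  u-u   : ∀ {i j} → toℕ j ≡ suc (toℕ i) → Edge n (u i) (u j)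
  u-v   : ∀ {i j} → suc (toℕ i) ≡ n → toℕ j ≡ 0 → Edge n (u i) (v j)
  v-v   : ∀ {i j} → toℕ j ≡ suc (toℕ i) → Edge n (v i) (v j)
  v-u   : ∀ {i j} → suc (toℕ i) ≡ n → toℕ j ≡ 0 → Edge n (v i) (u j)
  chord : ∀ i → Edge n (u i) (v i)

edge-irrefl : ∀ {n} x → ¬ Edge n x x
edge-irrefl (u i) (u-u eq) = 1+n≢n (sym eq)
edge-irrefl (v i) (v-v eq) = 1+n≢n (sym eq)

DG : ℕ → Graph
DG n = record
  { Vertex  = Fin n ⊎ Fin n
  ; order   = n + n
  ; finite  = +↔⊎
  ; Adj     = SymClosure (Edge n)
  ; adj-sym = symmetric (Edge n)
  ; no-loop = λ { x (fwd e) → edge-irrefl x e ; x (bwd e) → edge-irrefl x e }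
  }

{-# OPTIONS --safe #-}
-- A robber on a ladder whose last position is always occupied by a cop can only
-- march straight on or cross a rung.  Crossing a rung while the cops occupy both
-- of its ends cuts the ladder at that column.  So four cops hold the two columns
-- bounding the robber's strip, a fifth stays just behind him, and the sixth flies
-- to him: he either runs into the end of the strip or cuts it to a smaller one, in
-- which case the two cops on the far end are released.  At the start a single cop
-- on the robber's first vertex bounds his march along the Hamilton cycle, and one
-- column, seen from both sides, bounds the strip after the first crossing.
module Submission where

open import Defs
open import Data.Fin.Base using (Fin; zero; suc; toℕ; fromℕ; inject₁)
open import Data.Fin.Properties as Fin
  using (any?; ¬∀⟶∃¬; <⇒notInjective; toℕ-injective; toℕ-inject₁; toℕ-fromℕ)
open import Data.Fin.Relation.Unary.Top
  using (view; ‵fromℕ; ‵inj₁; ‵inject₁; view-fromℕ; view-inject₁)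
open import Data.List.Base using (List; []; _∷_; length; applyDownFrom)
open import Data.List.Membership.Propositional using (_∈_)
import Data.List.Membership.Propositional.Properties as ListMembership
open import Data.List.Relation.Unary.All as All using (All; []; _∷_)
open import Data.List.Relation.Unary.Any as Any using (here; there)
import Data.List.Relation.Unary.Any.Properties as Any
open import Data.Maybe.Base as Maybe using (Maybe; just; nothing)
open import Data.Maybe.Properties using (≡-dec)
open import Data.Nat.Base using (ℕ; zero; suc; _+_; _≤_; _<_; z≤n; s≤s)
open import Data.Nat.GeneralisedArithmetic using (iterate)
open import Data.Nat.Properties as ℕ
  using (≤-refl; ≤-trans; m≤m+n; m≤n+m; +-suc; suc-injective)
open import Data.Product.Base using (_×_; _,_; ∃-syntax; proj₁; proj₂)
open import Data.Sum.Base using (_⊎_; inj₁; inj₂; swap)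
open import Data.Sum.Properties using (swap-involutive)
import Data.Vec.Base as Vec
import Data.Vec.Membership.Propositional as VecMembership
open import Data.Vec.Membership.DecPropositional using () renaming (_∈?_ to ∈-dec)
open import Data.Vec.Membership.Propositional.Properties using (∈-lookup)
open import Data.Vec.Properties using (lookup∘update; lookup∘update′)
import Data.Vec.Relation.Unary.Any as VecAny
import Data.Vec.Relation.Unary.Any.Properties as VecAny
open import Function.Base using (_∘_; case_of_)
open import Function.Properties.Inverse using (↔⇒↣; ↔-sym)
open import Relation.Binary.Construct.Closure.Symmetric using (SymClosure; fwd; bwd)
open import Relation.Binary.Definitions using (Decidable; DecidableEquality)
open import Relation.Binary.PropositionalEquality
open import Relation.Nullary using (¬_; Dec; yes; no; contradiction; ¬?)
open import Relation.Nullary.Decidable using (map′; via-injection; _×-dec_; _⊎-dec_)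

-- Iterated maps and a pigeonhole principle.

iterate-+ : ∀ {A : Set} (f : A → A) x k l → iterate f x (k + l) ≡ iterate f (iterate f x k) l
iterate-+ f x zero    l = refl
iterate-+ f x (suc k) l = iterate-+ f (f x) k l

-- `iterate` performs its first step innermost; taken with `h` equal to `f`, this moves a step from
-- the start of a run to its end.
iterate-comm : ∀ {A : Set} (f h : A → A) → (∀ x → h (f x) ≡ f (h x)) →
               ∀ x k → h (iterate f x k) ≡ iterate f (h x) k
iterate-comm f h comm x zero    = refl
iterate-comm f h comm x (suc k) =
  trans (iterate-comm f h comm (f x) k) (cong (λ z → iterate f z k) (comm x))

iterate-inverse : ∀ {A : Set} (g f : A → A) → (∀ x → g (f x) ≡ x) →
                  ∀ x k → iterate g (iterate f x k) k ≡ x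
iterate-inverse g f g∘f x zero    = refl
iterate-inverse g f g∘f x (suc k) = trans
  (cong (λ z → iterate g z k)
    (trans (cong g (sym (iterate-comm f f (λ _ → refl) x k))) (g∘f _)))
  (iterate-inverse g f g∘f x k)

-- Otherwise a choice of preimages would inject `Fin n` into the smaller `Fin m`.
notSurjective : ∀ {m n} → m < n → (φ : Fin m → Fin n) → ∃[ j ] ¬ (∃[ a ] φ a ≡ j)
notSurjective m<n φ =
  ¬∀⟶∃¬ _ _ (λ j → any? (λ a → φ a Fin.≟ j)) λ surj →
    <⇒notInjective {f = proj₁ ∘ surj} m<n λ {i} {j} eq →
      trans (sym (proj₂ (surj i))) (trans (cong φ eq) (proj₂ (surj j)))

-- From winning positions to strategies.

module CopsWin (G : Graph) where
  open Graph G
  open Entanglement G using (Cops; CopMove; Occupied; fly; Strategy; copsAt; RunsIndefinitely)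

  Legal : ∀ {k} → CopMove k → Cops k → Vertex → Vertex → Set
  Legal m c r r′ = Adj r r′ × ¬ Occupied (fly m r c) r′

  -- Being inductive, it admits only finite play; the base case is a robber without legal moves,
  -- where the continuation is vacuous.
  data Win {k} (c : Cops k) (r : Vertex) : Set where
    turn : (m : CopMove k) → (∀ r′ → Legal m c r r′ → Win (fly m r c) r′) → Win c r

  -- Which cops hold the vertices xs is immaterial: with fewer than k of them to
  -- hold, some cop can always be spared.
  Trapped : ℕ → List Vertex → Vertex → Set
  Trapped k xs r = (c : Cops k) → All (Occupied c) xs → Win c r

  trapped-⊆ : ∀ {k xs ys r} → All (_∈ ys) xs → Trapped k xs r → Trapped k ys r
  trapped-⊆ xs⊆ys t c occ = t c (All.map (All.lookup occ) xs⊆ys)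

  occupied-after : ∀ {k x} {c : Cops k} j r (occ : Occupied c x) → VecAny.index occ ≢ j →
                   Occupied (fly (just j) r c) x
  occupied-after {c = c} j r occ i≢j =
    subst (VecMembership._∈ _)
      (trans (lookup∘update′ i≢j c (just r)) (sym (VecAny.lookup-index occ)))
      (∈-lookup (VecAny.index occ) (fly (just j) r c))

  occupied-landing : ∀ {k} (c : Cops k) j r → Occupied (fly (just j) r c) r
  occupied-landing c j r =
    subst (VecMembership._∈ fly (just j) r c) (lookup∘update j c (just r))
      (∈-lookup j (fly (just j) r c))

  -- One witness of occupation per entry of `xs` singles out fewer than `k` cops, so some cop is not
  -- among them and may leave without freeing an entry.
  spare : ∀ {k xs} (c : Cops k) → length xs < k → All (Occupied c) xs →
          ∃[ j ] (∀ r → All (Occupied (fly (just j) r c)) (r ∷ xs))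
  spare {xs = xs} c len occ =
    let occAt a       = All.lookup occ (ListMembership.∈-lookup {xs = xs} a)
        j , unused    = notSurjective len (VecAny.index ∘ occAt)
    in j , λ r → occupied-landing c j r ∷ All.tabulate λ x∈xs →
         subst (Occupied _) (sym (Any.lookup-index x∈xs))
           (occupied-after j r (occAt (Any.index x∈xs)) (unused ∘ (Any.index x∈xs ,_)))

  trap : ∀ {k xs r} → length xs < k →
         (∀ r′ → Adj r r′ → r′ ∈ r ∷ xs ⊎ Trapped k (r ∷ xs) r′) → Trapped k xs r
  trap {r = r} len after c occ with j , occ′ ← spare c len occ =
    turn (just j) λ { r′ (adj , free) → case after r′ adj of λ where
      (inj₁ r′∈xs) → contradiction (All.lookup (occ′ r) r′∈xs) free
      (inj₂ t)     → t (fly (just j) r c) (occ′ r) }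

  module _ (adj? : Decidable Adj) where

    _≟ᵛ_ : DecidableEquality Vertex
    _≟ᵛ_ = via-injection (↔⇒↣ (↔-sym finite)) Fin._≟_

    legal? : ∀ {k} (m : CopMove k) c r r′ → Dec (Legal m c r r′)
    legal? m c r r′ = adj? r r′ ×-dec ¬? (∈-dec (≡-dec _≟ᵛ_) (just r′) (fly m r c))

    Position : ℕ → Set
    Position k = ∃[ c ] ∃[ r ] Win {k} c r

    module _ {k} (start : ∀ r → Win (Vec.replicate k nothing) r) where

      advance : Vertex → Position k → Maybe (Position k)
      advance r′ (c , r , turn m next) with legal? m c r r′
      ... | yes legal = just (_ , _ , next r′ legal)
      ... | no  _     = nothing

      -- A strategy sees only the robber's history, so the winning tree is replayed along it,
      -- beginning with the last entry, his starting vertex.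
      position : List Vertex → Maybe (Position k)
      position []           = nothing
      position (r ∷ [])     = just (_ , r , start r)
      position (r ∷ h@(_ ∷ _)) = position h Maybe.>>= advance r

      move : Position k → CopMove k
      move (_ , _ , turn m _) = m

      strategy : Strategy k
      strategy h = position h Maybe.>>= move

      -- Induction on `w`: the replayed position agrees with the actual one, and each legal move of
      -- the robber descends to a proper subtree.
      finite-play : ∀ ρ → RunsIndefinitely strategy ρ → ∀ t {c} → copsAt strategy ρ t ≡ c →
                    (w : Win c (ρ t)) → position (applyDownFrom ρ (suc t)) ≢ just (c , ρ t , w)
      finite-play ρ legal t {c} refl (turn m next) eq = continue (legal? m c (ρ t) (ρ (suc t))) refl
        where
        moved : copsAt strategy ρ (suc t) ≡ fly m (ρ t) c
        moved = cong (λ p → fly (p Maybe.>>= move) (ρ t) c) eq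
        continue : (d : Dec (Legal m c (ρ t) (ρ (suc t)))) → legal? m c (ρ t) (ρ (suc t)) ≢ d
        continue (no illegal) _ with adj , free ← legal t =
          illegal (adj , subst (λ c′ → ¬ Occupied c′ _) moved free)
        continue (yes l) eq′ = finite-play ρ legal (suc t) moved (next _ l)
          (trans (cong (Maybe._>>= advance (ρ (suc t))) eq) adv)
          where
          adv : advance (ρ (suc t)) (c , ρ t , turn m next) ≡ just (_ , _ , next _ l)
          adv rewrite eq′ = refl

      copsSuffice : CopsSuffice G k
      copsSuffice = strategy , λ ρ legal → finite-play ρ legal 0 refl (start (ρ 0)) refl

-- Confining the robber on a twisted ladder.

-- 2 + m is the number of rungs.
module Ladder (G : Graph) (opp : Graph.Vertex G → Graph.Vertex G)
              (opp-involutive : ∀ x → opp (opp x) ≡ x) (m : ℕ) where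
  open Graph G
  open CopsWin G

  -- Kept abstract so that `reverse` gives the mirror image of every argument. `f-half` is the
  -- twist: passing all rungs once leads to the other end of the starting rung.
  record Direction (f g : Vertex → Vertex) : Set where
    field
      f∘g       : ∀ x → f (g x) ≡ x
      g∘f       : ∀ x → g (f x) ≡ x
      opp-f     : ∀ x → opp (f x) ≡ f (opp x)
      opp-g     : ∀ x → opp (g x) ≡ g (opp x)
      f-half    : ∀ x → iterate f x (2 + m) ≡ opp x
      g-half    : ∀ x → iterate g x (2 + m) ≡ opp x
      neighbour : ∀ {x y} → Adj x y → y ≡ f x ⊎ y ≡ g x ⊎ y ≡ opp x

  reverse : ∀ {f g} → Direction f g → Direction g f
  reverse d = record
    { f∘g = g∘f ; g∘f = f∘g ; opp-f = opp-g ; opp-g = opp-f ; f-half = g-half ; g-half = f-half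
    ; neighbour = λ e → case neighbour e of λ where
        (inj₁ p)        → inj₂ (inj₁ p)
        (inj₂ (inj₁ p)) → inj₁ p
        (inj₂ (inj₂ p)) → inj₂ (inj₂ p) }
    where open Direction d

  Settled : List Vertex → Vertex → Set
  Settled xs r = r ∈ xs ⊎ Trapped 6 xs r

  settled-⊆ : ∀ {xs ys r} → All (_∈ ys) xs → Settled xs r → Settled ys r
  settled-⊆ xs⊆ys (inj₁ r∈xs) = inj₁ (All.lookup xs⊆ys r∈xs)
  settled-⊆ xs⊆ys (inj₂ t)    = inj₂ (trapped-⊆ xs⊆ys t)

  module _ {f g} (d : Direction f g) where
    open Direction d

    squeeze : ∀ {xs r} → length xs < 6 → Settled (r ∷ xs) (f r) → Settled (r ∷ xs) (g r) →
              Settled (r ∷ xs) (opp r) → Trapped 6 xs r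
    squeeze len sf sg so = trap len λ r′ e → case neighbour e of λ where
      (inj₁ refl)        → sf
      (inj₂ (inj₁ refl)) → sg
      (inj₂ (inj₂ refl)) → so

  pattern 0th p = here p
  pattern 1st p = there (here p)
  pattern 2nd p = there (1st p)
  pattern 3rd p = there (2nd p)
  pattern 4th p = there (3rd p)
  pattern 5th p = there (4th p)

  -- The robber at y just came from g y; l and r columns separate his own from the
  -- columns {B, B′} and {F, F′}.
  mutual
    march : ∀ N l r → l + r ≤ N → ∀ {f g} → Direction f g → ∀ {y B B′ F F′} →
            B ≡ iterate g y (suc l) → B′ ≡ iterate g (opp y) (suc l) →
            F ≡ iterate f y (suc r) → F′ ≡ iterate f (opp y) (suc r) →
            Trapped 6 (B ∷ B′ ∷ F ∷ F′ ∷ g y ∷ []) y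
    march N l r l+r≤N {f} {g} d {y} {B} {B′} {F} {F′} B≡ B′≡ F≡ F′≡ =
      squeeze d ≤-refl (ahead r l+r≤N F≡ F′≡) (inj₁ (5th refl)) (inj₂ (trapped-⊆
        (1st refl ∷ 2nd refl ∷ 3rd refl ∷ 4th refl ∷ 0th refl ∷ [])
        -- He has crossed to `opp y`. Dropping `g y` frees a cop to follow him there; both ends of
        -- the rung are then held, and he can only continue on one side of it.
        (squeeze d {B ∷ B′ ∷ F ∷ F′ ∷ y ∷ []} ≤-refl
          (settled-⊆ (0th refl ∷ 5th refl ∷ 3rd refl ∷ 4th refl ∷ [])
            (cut N r (≤-trans (m≤n+m r l) l+r≤N) d F≡ F′≡))
          (settled-⊆ (0th refl ∷ 5th refl ∷ 1st refl ∷ 2nd refl ∷ [])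
            (cut N l (≤-trans (m≤m+n l r) l+r≤N) (reverse d) B≡ B′≡))
          (inj₁ (5th (opp-involutive y))))))
      where
      open Direction d
      ahead : ∀ r → l + r ≤ N → F ≡ iterate f y (suc r) → F′ ≡ iterate f (opp y) (suc r) →
              Settled (y ∷ B ∷ B′ ∷ F ∷ F′ ∷ g y ∷ []) (f y)
      ahead zero    _     F≡ _   = inj₁ (3rd (sym F≡))
      -- A column passes from the front to the back: `l + r` and `N` are unchanged while `r` drops,
      -- and `y` becomes the vertex just behind him.
      ahead (suc r) l+r≤N F≡ F′≡ = inj₂ (trapped-⊆
        (1st refl ∷ 2nd refl ∷ 3rd refl ∷ 4th refl ∷ 0th (g∘f y) ∷ [])
        (march N (suc l) r (subst (_≤ N) (+-suc l r) l+r≤N) d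
          (trans B≡ (cong (λ z → iterate g z (suc l)) (sym (g∘f y))))
          (trans B′≡ (cong (λ z → iterate g z (suc l))
            (trans (sym (g∘f (opp y))) (cong g (sym (opp-f y))))))
          F≡
          (trans F′≡ (cong (λ z → iterate f z (suc r)) (sym (opp-f y))))))

    -- The column just crossed becomes a boundary of the new strip, so the next march has a smaller
    -- `N`. This makes the mutual recursion terminate.
    cut : ∀ N r → r ≤ N → ∀ {f g} → Direction f g → ∀ {y F F′} →
          F ≡ iterate f y (suc r) → F′ ≡ iterate f (opp y) (suc r) →
          Settled (opp y ∷ y ∷ F ∷ F′ ∷ []) (f (opp y))
    cut N       zero    _         d F≡ F′≡ = inj₁ (3rd (sym F′≡))
    cut (suc N) (suc r) (s≤s r≤N) {f} {g} d {y} F≡ F′≡ = inj₂ (trapped-⊆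
      -- `F` and `F′` trade places because he is now on the other rail; `opp y` is both an end of
      -- the bounding column and the vertex behind him.
      (0th refl ∷ 1st refl ∷ 3rd refl ∷ 2nd refl ∷ 0th (g∘f (opp y)) ∷ [])
      (march N 0 r r≤N d
        (sym (g∘f (opp y)))
        (sym (trans (cong g opp-f-opp) (g∘f y)))
        F′≡
        (trans F≡ (cong (λ z → iterate f z (suc r)) (sym opp-f-opp)))))
      where
      open Direction d
      opp-f-opp : opp (f (opp y)) ≡ f y
      opp-f-opp = trans (opp-f (opp y)) (cong f (opp-involutive y))

  module _ {f g} (d : Direction f g) where
    open Direction d

    -- By the twist, one trip around the ladder meets the column of `y` again with its ends
    -- exchanged. It bounds the strip on both sides, with the other `suc m` columns between.
    column : ∀ y → Trapped 6 (y ∷ []) (opp y)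
    column y = squeeze d (s≤s (s≤s z≤n)) (beyond d) (beyond (reverse d))
      (inj₁ (1st (opp-involutive y)))
      where
      beyond : ∀ {f g} → Direction f g → Settled (opp y ∷ y ∷ []) (f (opp y))
      beyond d = settled-⊆ (0th refl ∷ 1st refl ∷ 0th refl ∷ 1st refl ∷ [])
        (cut (suc m) (suc m) ≤-refl d (sym (D.f-half y))
          (sym (trans (D.f-half (opp y)) (opp-involutive y))))
        where module D = Direction d

    -- Until the first crossing, `x` is the barrier ahead, `suc r` steps on. A crossing at `y` needs
    -- only `y` held, by `column`.
    circuit : ∀ r {x y} → x ≡ iterate f y (suc r) → Trapped 6 (x ∷ g y ∷ []) y
    circuit r {x} {y} x≡ = squeeze d (s≤s (s≤s (s≤s z≤n))) (ahead r x≡) (inj₁ (2nd refl))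
      (inj₂ (trapped-⊆ (0th refl ∷ []) (column y)))
      where
      ahead : ∀ r → x ≡ iterate f y (suc r) → Settled (y ∷ x ∷ g y ∷ []) (f y)
      ahead zero    x≡ = inj₁ (1st (sym x≡))
      ahead (suc r) x≡ = inj₂ (trapped-⊆ (1st refl ∷ 0th (g∘f y) ∷ []) (circuit r x≡))

  trapped : ∀ {f g} → Direction f g → ∀ x → Trapped 6 [] x
  trapped d x = squeeze d (s≤s z≤n) (leave d) (leave (reverse d)) (inj₂ (column d x))
    where
    leave : ∀ {f g} → Direction f g → Settled (x ∷ []) (f x)
    leave {f} d = inj₂ (trapped-⊆ (0th refl ∷ 0th (g∘f x) ∷ [])
      -- The cycle has `2 + m + (2 + m)` vertices; one step is already made and `circuit` counts one
      -- more than its argument. Here `x` is both the barrier ahead and the vertex behind.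
      (circuit d (m + (2 + m)) (sym full)))
      where
      open Direction d
      full : iterate f x (2 + m + (2 + m)) ≡ x
      full = trans (iterate-+ f x (2 + m) (2 + m))
        (trans (cong (λ z → iterate f z (2 + m)) (f-half x))
          (trans (f-half (opp x)) (opp-involutive x)))

-- Decidability of adjacency.

symClosure? : ∀ {A : Set} {R : A → A → Set} → Decidable R → Decidable (SymClosure R)
symClosure? R? x y = map′
  (λ { (inj₁ p) → fwd p ; (inj₂ p) → bwd p }) (λ { (fwd p) → inj₁ p ; (bwd p) → inj₂ p })
  (R? x y ⊎-dec R? y x)

edge? : ∀ {n} → Decidable (Edge n)
edge? (u i) (u j) = map′ u-u (λ { (u-u p) → p }) (toℕ j ℕ.≟ suc (toℕ i))
edge? (v i) (v j) = map′ v-v (λ { (v-v p) → p }) (toℕ j ℕ.≟ suc (toℕ i))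
edge? (v i) (u j) = map′ (λ (p , q) → v-u p q) (λ { (v-u p q) → p , q })
  ((suc (toℕ i) ℕ.≟ _) ×-dec (toℕ j ℕ.≟ 0))
edge? (u i) (v j) = map′
  (λ { (inj₁ (p , q)) → u-v p q ; (inj₂ refl) → chord i })
  (λ { (u-v p q) → inj₁ (p , q) ; (chord _) → inj₂ refl })
  (((suc (toℕ i) ℕ.≟ _) ×-dec (toℕ j ℕ.≟ 0)) ⊎-dec (i Fin.≟ j))

-- The rotation of the Hamilton cycle.

module Möbius (n : ℕ) where

  V : Set
  V = Fin (suc n) ⊎ Fin (suc n)

  -- Only the `u` half is defined by cases. The `v` half is its image under `swap`, so facts about
  -- the rotation transfer from one half to the other.
  next-u prev-u : Fin (suc n) → V
  next-u i with view i
  ... | ‵fromℕ     = v zero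
  ... | ‵inject₁ j = u (suc j)
  prev-u zero    = v (fromℕ n)
  prev-u (suc j) = u (inject₁ j)

  next prev : V → V
  next (u i) = next-u i
  next (v i) = swap (next-u i)
  prev (u i) = prev-u i
  prev (v i) = swap (prev-u i)

  next-u-last : next (u (fromℕ n)) ≡ v zero
  next-u-last rewrite view-fromℕ n = refl

  next-u-inject₁ : ∀ j → next (u (inject₁ j)) ≡ u (suc j)
  next-u-inject₁ j rewrite view-inject₁ j = refl

  swap-next : ∀ x → swap (next x) ≡ next (swap x)
  swap-next (u i) = refl
  swap-next (v i) = swap-involutive (next (u i))

  swap-prev : ∀ x → swap (prev x) ≡ prev (swap x)
  swap-prev (u i) = refl
  swap-prev (v i) = swap-involutive (prev (u i))

  next-prev-u : ∀ i → next (prev (u i)) ≡ u i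
  next-prev-u zero    = cong swap next-u-last
  next-prev-u (suc j) = next-u-inject₁ j

  next-prev : ∀ x → next (prev x) ≡ x
  next-prev (u i) = next-prev-u i
  next-prev (v i) = trans (sym (swap-next (prev (u i)))) (cong swap (next-prev-u i))

  prev-next-u : ∀ i → prev (next (u i)) ≡ u i
  prev-next-u i with view i
  ... | ‵fromℕ     = refl
  ... | ‵inject₁ j = refl

  prev-next : ∀ x → prev (next x) ≡ x
  prev-next (u i) = prev-next-u i
  prev-next (v i) = trans (sym (swap-prev (next (u i)))) (cong swap (prev-next-u i))

  next-last : ∀ {i : Fin (suc n)} → suc (toℕ i) ≡ suc n → next (u i) ≡ v zero
  next-last p = trans
    (cong next-u (toℕ-injective (trans (suc-injective p) (sym (toℕ-fromℕ n))))) next-u-last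

  next-suc : ∀ {i j : Fin (suc n)} → toℕ j ≡ suc (toℕ i) → next (u i) ≡ u j
  next-suc {j = suc j} p = trans
    (cong next-u (toℕ-injective (trans (suc-injective (sym p)) (sym (toℕ-inject₁ j)))))
    (next-u-inject₁ j)

  edge⇒next : ∀ {x y} → Edge (suc n) x y → y ≡ next x ⊎ y ≡ swap x
  edge⇒next (u-u p)                  = inj₁ (sym (next-suc p))
  edge⇒next (v-v p)                  = inj₁ (cong swap (sym (next-suc p)))
  edge⇒next (u-v {j = zero} p refl)  = inj₁ (sym (next-last p))
  edge⇒next (v-u {j = zero} p refl)  = inj₁ (cong swap (sym (next-last p)))
  edge⇒next (chord i)                = inj₂ refl

  neighbour : ∀ {x y} → Graph.Adj (DG (suc n)) x y → y ≡ next x ⊎ y ≡ prev x ⊎ y ≡ swap x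
  neighbour (fwd e) with edge⇒next e
  ... | inj₁ p = inj₁ p
  ... | inj₂ p = inj₂ (inj₂ p)
  neighbour (bwd e) with edge⇒next e
  ... | inj₁ refl = inj₂ (inj₁ (sym (prev-next _)))
  ... | inj₂ refl = inj₂ (inj₂ (sym (swap-involutive _)))

  iterate-next-zero : ∀ k {i : Fin (suc n)} → toℕ i ≡ k → iterate next (u zero) k ≡ u i
  iterate-next-zero zero    {zero}  _ = refl
  iterate-next-zero (suc k) {suc j} p = begin
    iterate next (next (u zero)) k  ≡⟨ iterate-comm next next (λ _ → refl) (u zero) k ⟨
    next (iterate next (u zero) k)  ≡⟨ cong next (iterate-next-zero k j≡k) ⟩
    next (u (inject₁ j))            ≡⟨ next-u-inject₁ j ⟩
    u (suc j)                       ∎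
    where
    open ≡-Reasoning
    j≡k = trans (toℕ-inject₁ j) (suc-injective p)

  -- Start from `u zero` and exchange the order of the two runs: `suc n` steps lead to `v zero`, and
  -- `toℕ i` more mirror the run from `u zero` to `u i`.
  next-half-u : ∀ i → iterate next (u i) (suc n) ≡ v i
  next-half-u i = begin
    iterate next (u i) (suc n)
      ≡⟨ cong (λ x → iterate next x (suc n)) (iterate-next-zero (toℕ i) refl) ⟨
    iterate next (iterate next (u zero) (toℕ i)) (suc n)
      ≡⟨ iterate-+ next (u zero) (toℕ i) (suc n) ⟨
    iterate next (u zero) (toℕ i + suc n)
      ≡⟨ cong (iterate next (u zero)) (ℕ.+-comm (toℕ i) (suc n)) ⟩
    iterate next (next (u zero)) (n + toℕ i)
      ≡⟨ iterate-+ next (next (u zero)) n (toℕ i) ⟩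
    iterate next (iterate next (next (u zero)) n) (toℕ i)
      ≡⟨ cong (λ x → iterate next x (toℕ i)) (iterate-comm next next (λ _ → refl) (u zero) n) ⟨
    iterate next (next (iterate next (u zero) n)) (toℕ i)
      ≡⟨ cong (λ x → iterate next (next x) (toℕ i)) (iterate-next-zero n (toℕ-fromℕ n)) ⟩
    iterate next (next (u (fromℕ n))) (toℕ i)
      ≡⟨ cong (λ x → iterate next x (toℕ i)) next-u-last ⟩
    iterate next (v zero) (toℕ i)
      ≡⟨ iterate-comm next swap swap-next (u zero) (toℕ i) ⟨
    swap (iterate next (u zero) (toℕ i))
      ≡⟨ cong swap (iterate-next-zero (toℕ i) refl) ⟩
    v i ∎
    where open ≡-Reasoning

  next-half : ∀ x → iterate next x (suc n) ≡ swap x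
  next-half (u i) = next-half-u i
  next-half (v i) = trans (sym (iterate-comm next swap swap-next (u i) (suc n))) (cong swap (next-half-u i))

  -- A forward half turn takes `swap x` to `x`; running backwards undoes it.
  prev-half : ∀ x → iterate prev x (suc n) ≡ swap x
  prev-half x = begin
    iterate prev x (suc n)
      ≡⟨ cong (λ z → iterate prev z (suc n)) (trans (next-half (swap x)) (swap-involutive x)) ⟨
    iterate prev (iterate next (swap x) (suc n)) (suc n)
      ≡⟨ iterate-inverse prev next prev-next (swap x) (suc n) ⟩
    swap x ∎
    where open ≡-Reasoning

proposition1 : (n : ℕ) → 2 ≤ n → CopsSuffice (DG n) 6 × (∀ e → IsEnt (DG n) e → e ≤ 6)
proposition1 (suc (suc m)) (s≤s (s≤s _)) = suffice , λ e isEnt → proj₂ isEnt 6 suffice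
  where
  open Möbius (suc m)
  open CopsWin (DG (2 + m))
  open Ladder (DG (2 + m)) swap swap-involutive m
  direction : Direction next prev
  direction = record
    { f∘g = next-prev ; g∘f = prev-next ; opp-f = swap-next ; opp-g = swap-prev
    ; f-half = next-half ; g-half = prev-half ; neighbour = neighbour }
  suffice : CopsSuffice (DG (2 + m)) 6
  -- The trap with an empty list demands no held vertex, so it applies to the initial placement with
  -- all cops outside.
  suffice = copsSuffice (symClosure? edge?) λ r → trapped direction r _ []
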